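{- Let $A$ be a finite alphabet. For all words $x,y\in A^*$, all integers $k\ge 0$ and all letters $a_1,\ldots,a_k\in A$, we have $$\binom{xy}{a_1\cdots a_k}_q=\sum_{j=0}^k q^{\,j(|y|-k+j)}\binom{x}{a_1\cdots a_j}_q\binom{y}{a_{j+1}\cdots a_k}_q .$$
   Context: $A^*$ is the free monoid of finite words over $A$ (with concatenation and empty word $\varepsilon$), and $|w|$ is the length of a word $w$. The $q$-binomial coefficient $\binom{u}{v}_q\in\mathbb{N}[q]$ of two words $u,v\in A^*$ is defined recursively by $\binom{u}{\varepsilon}_q=1$, $\binom{\varepsilon}{v}_q=0$ if $v\neq\varepsilon$, and, for all $u,v\in A^*$ and letters $a,b\in A$, $\binom{ua}{vb}_q=q^{|vb|}\binom{u}{vb}_q+\delta_{a,b}\binom{u}{v}_q$, where $\delta_{a,b}$ is the Kronecker delta. The empty product of letters is $\varepsilon$. The identity is read in $\mathbb{Z}[q,q^{ -1}]$; whenever an exponent of $q$ in the sum is negative, the corresponding term is zero because a $q$-binomial factor vanishes. -}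

module Defs where

open import Algebra.Bundles.Raw using (RawMonoid; RawSemiring)
open import Data.Bool.Base using (if_then_else_)
import Data.Integer.Base as ℤ
import Data.Integer.Properties as ℤ
open import Data.List.Base
  using (List; []; _∷_; _++_; _∷ʳ_; [_]; length; reverse; map; foldr; upTo; cartesianProductWith)
open import Data.List.Properties using (reverse-++; length-reverse; reverse-involutive)
open import Data.Nat.Base as ℕ using (ℕ; suc)
import Data.Nat.Properties as ℕ
open import Data.Product.Base using (_×_; _,_)
open import Level using (0ℓ)
open import Relation.Binary.Definitions using (Decidable; DecidableEquality)
open import Relation.Binary.PropositionalEquality
  using (_≡_; _≢_; refl; sym; cong; trans)
open import Relation.Nullary.Decidable.Core using (does)
open import Relation.Nullary.Negation using (contradiction)

-- The monoid semiring C[E], i.e. finite formal sums of terms c q^e with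
-- c in the semiring C and e in the monoid E.  Representatives are lists of
-- terms (c , e); exponents may repeat and coefficients may be zero, and _≈_
-- identifies two lists when all their collected coefficients agree.

module MonoidSemiring
  (C : RawSemiring 0ℓ 0ℓ) (E : RawMonoid 0ℓ 0ℓ)
  (_≟ₑ_ : Decidable (RawMonoid._≈_ E))
  where

  private
    module C = RawSemiring C
    module E = RawMonoid E

  infixl 7 _*_
  infixl 6 _+_
  infix  4 _≈_

  Carrier : Set
  Carrier = List (C.Carrier × E.Carrier)

  coeff : Carrier → E.Carrier → C.Carrier
  coeff p e =
    foldr (λ (c , d) s → (if does (d ≟ₑ e) then c else C.0#) C.+ s) C.0# p

  _≈_ : Carrier → Carrier → Set
  p ≈ r = ∀ e → coeff p e C.≈ coeff r e

  0# : Carrier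
  0# = []

  q^_ : E.Carrier → Carrier
  q^ e = [ C.1# , e ]

  1# : Carrier
  1# = q^ E.ε

  _+_ : Carrier → Carrier → Carrier
  _+_ = _++_

  _*_ : Carrier → Carrier → Carrier
  _*_ = cartesianProductWith λ (c , d) (c′ , d′) → c C.* c′ , d E.∙ d′

  Σ≤ : ℕ → (ℕ → Carrier) → Carrier
  Σ≤ k f = foldr _+_ 0# (map f (upTo (suc k)))

module ℕ[q] = MonoidSemiring ℕ.+-*-rawSemiring ℕ.+-0-rawMonoid ℕ._≟_

module ℤ[q,q⁻¹] = MonoidSemiring ℤ.+-*-rawSemiring ℤ.+-0-rawMonoid ℤ._≟_

ι : ℕ[q].Carrier → ℤ[q,q⁻¹].Carrier
ι = map λ (c , e) → ℤ.+ c , ℤ.+ e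

module QBinomial {a} {A : Set a} (_≟_ : DecidableEquality A) where

  open ℕ[q]

  δ : A → A → Carrier
  δ x y = if does (x ≟ y) then 1# else 0#

  -- The defining recursion removes the last letters of the words, so it is
  -- carried out on the reversed words; the lemmas below recover it as stated
  -- for the words themselves.
  binomʳ : List A → List A → Carrier
  binomʳ u       []      = 1#
  binomʳ []      (_ ∷ _) = 0#
  binomʳ (x ∷ u) (y ∷ v) =
    q^ length (y ∷ v) * binomʳ u (y ∷ v) + δ x y * binomʳ u v

  binom : List A → List A → Carrier
  binom u v = binomʳ (reverse u) (reverse v)

  binom-ε : ∀ u → binom u [] ≡ 1#
  binom-ε u = refl

  ε-binom : ∀ v → v ≢ [] → binom [] v ≡ 0#
  ε-binom v v≢[] with reverse v in eq
  ... | []    = contradiction (trans (sym (reverse-involutive v)) (cong reverse eq)) v≢[]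
  ... | _ ∷ _ = refl

  binom-∷ʳ : ∀ u v x y →
    binom (u ∷ʳ x) (v ∷ʳ y) ≡
      q^ length (v ∷ʳ y) * binom u (v ∷ʳ y) + δ x y * binom u v
  binom-∷ʳ u v x y
    rewrite reverse-++ u [ x ]
          | sym (length-reverse (v ∷ʳ y))
          | reverse-++ v [ y ]
    = refl

{-# OPTIONS --safe #-}
module Submission where

-- Induct on y from its last letter.  Expanding binom (x ++ y) v and each
-- binom y (drop j v) by the defining recursion, the two sides match summand
-- by summand because the exponents satisfy
--   j (|y| + 1 - k + j) + (k - j) = k + j (|y| - k + j).
-- Both sides even agree as multisets of terms c q^e, so the computation takes
-- place in the semiring of lists of terms up to permutation.

open import Defs
open import Algebra.Bundles using (CommutativeSemiring)
open import Algebra.Core using (Op₂)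
import Algebra.Definitions as Definitions
import Algebra.Properties.CommutativeSemigroup as CommutativeSemigroupProperties
import Algebra.Properties.Semiring.Sum as SemiringSum
open import Algebra.Structures using (IsCommutativeMonoid; IsCommutativeSemiring)
import Algebra.Structures.Biased as Biased
open import Data.Bool.Base using (if_then_else_)
open import Data.Nat.Base as ℕ using (ℕ; zero; suc; _≤_; s≤s⁻¹)
import Data.Nat.Properties as ℕ
open import Data.Integer.Base as ℤ using (ℤ; +_; _+_; _-_; _*_)
import Data.Integer.Properties as ℤ
open import Data.Integer.Tactic.RingSolver using (solve-∀)
open import Data.Fin.Base using (Fin; toℕ)
open import Data.Fin.Properties using (inj⇒≟; toℕ<n; toℕ-inject₁; toℕ-fromℕ)
open import Data.List.Base
  using (List; []; _∷_; _++_; _∷ʳ_; [_]; length; take; drop; map; foldr; applyUpTo;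
         cartesianProductWith; initLast; _∷ʳ′_)
open import Data.List.Properties
  using (++-assoc; ++-identityʳ; map-++; map-∘; map-cong; map-id; map-applyUpTo; length-++;
         length-drop; take-all; drop-all;
         cartesianProductWith-zeroʳ; cartesianProductWith-distribʳ-++)
open import Data.List.Relation.Binary.Permutation.Propositional
  using (_↭_; refl; prep; swap; trans; ↭-refl; ↭-sym; ↭-reflexive; ↭-isEquivalence;
         module PermutationReasoning)
open import Data.List.Relation.Binary.Permutation.Propositional.Properties
  using (map⁺; ++⁺; ++⁺ˡ; shifts; ++-isCommutativeMonoid)
open import Data.List.Reverse using (Reverse; []; _∶_∶ʳ_; reverseView)
open import Data.Product.Base using (_×_; _,_)
open import Data.Vec.Base using (Vec; toList)
open import Data.Vec.Properties using (length-toList)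
open import Function.Base using (_∘_)
open import Function.Bundles using (_↔_)
open import Function.Properties.Inverse using (↔⇒↣)
open import Level using (Level; 0ℓ)
open import Relation.Binary.Definitions using (DecidableEquality)
open import Relation.Binary.PropositionalEquality as ≡
  using (_≡_; _≢_; cong; cong₂; module ≡-Reasoning)
open import Relation.Nullary.Decidable.Core using (does)

private
  variable
    a : Level
    A : Set a

-- Prefixes and suffixes of an extended list

take-++-≤ : ∀ {n} (xs ys : List A) → n ≤ length xs → take n (xs ++ ys) ≡ take n xs
take-++-≤ {n = zero}  xs       ys _ = ≡.refl
take-++-≤ {n = suc n} (x ∷ xs) ys p = cong (x ∷_) (take-++-≤ xs ys (s≤s⁻¹ p))

drop-++-≤ : ∀ {n} (xs ys : List A) → n ≤ length xs → drop n (xs ++ ys) ≡ drop n xs ++ ys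
drop-++-≤ {n = zero}  xs       ys _ = ≡.refl
drop-++-≤ {n = suc n} (x ∷ xs) ys p = drop-++-≤ xs ys (s≤s⁻¹ p)

length-∷ʳ : ∀ (xs : List A) x → length (xs ∷ʳ x) ≡ suc (length xs)
length-∷ʳ xs x = ≡.trans (length-++ xs) (ℕ.+-comm (length xs) 1)

∷ʳ-≢[] : ∀ (xs : List A) x → xs ∷ʳ x ≢ []
∷ʳ-≢[] []       x ()
∷ʳ-≢[] (_ ∷ xs) x ()

-- Lists over a commutative monoid

module _ {_∙_ : Op₂ A} {ε : A} (isCommutativeMonoid : IsCommutativeMonoid _≡_ _∙_ ε) where

  private
    module M = IsCommutativeMonoid isCommutativeMonoid
    open Definitions (_↭_ {A = A})

    infixl 7 _⊛_
    _⊛_ : Op₂ (List A)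
    _⊛_ = cartesianProductWith _∙_

    ⊛-congˡ : ∀ xs {ys zs} → ys ↭ zs → xs ⊛ ys ↭ xs ⊛ zs
    ⊛-congˡ []       p = ↭-refl
    ⊛-congˡ (x ∷ xs) p = ++⁺ (map⁺ (x ∙_) p) (⊛-congˡ xs p)

    -- `cartesianProductWith` recurses on its left factor, so it lists products row by row. Peeling
    -- off a column instead costs a permutation, and is what commutativity needs.
    ⊛-∷ʳ : ∀ xs y ys → xs ⊛ (y ∷ ys) ↭ map (y ∙_) xs ++ xs ⊛ ys
    ⊛-∷ʳ []       y ys = ↭-refl
    ⊛-∷ʳ (x ∷ xs) y ys rewrite M.comm x y = prep (y ∙ x) (begin
      map (x ∙_) ys ++ xs ⊛ (y ∷ ys)              ↭⟨ ++⁺ˡ (map (x ∙_) ys) (⊛-∷ʳ xs y ys) ⟩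
      map (x ∙_) ys ++ map (y ∙_) xs ++ xs ⊛ ys   ↭⟨ shifts (map (x ∙_) ys) (map (y ∙_) xs) ⟩
      map (y ∙_) xs ++ map (x ∙_) ys ++ xs ⊛ ys   ∎)
      where open PermutationReasoning

    ⊛-comm : Commutative _⊛_
    ⊛-comm []       ys = ↭-reflexive (≡.sym (cartesianProductWith-zeroʳ _∙_ ys))
    ⊛-comm (x ∷ xs) ys =
      trans (++⁺ˡ (map (x ∙_) ys) (⊛-comm xs ys)) (↭-sym (⊛-∷ʳ ys x xs))

    map-⊛ : ∀ x ys zs → map (x ∙_) ys ⊛ zs ≡ map (x ∙_) (ys ⊛ zs)
    map-⊛ x []       zs = ≡.refl
    map-⊛ x (y ∷ ys) zs = begin
      map ((x ∙ y) ∙_) zs ++ map (x ∙_) ys ⊛ zs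
        ≡⟨ cong₂ _++_ (≡.trans (map-cong (M.assoc x y) zs) (map-∘ zs)) (map-⊛ x ys zs) ⟩
      map (x ∙_) (map (y ∙_) zs) ++ map (x ∙_) (ys ⊛ zs)
        ≡⟨ map-++ (x ∙_) (map (y ∙_) zs) (ys ⊛ zs) ⟨
      map (x ∙_) (map (y ∙_) zs ++ ys ⊛ zs) ∎
      where open ≡-Reasoning

    -- An equality of lists: both sides run through the triples in lexicographic order.
    ⊛-assoc : ∀ xs ys zs → (xs ⊛ ys) ⊛ zs ≡ xs ⊛ (ys ⊛ zs)
    ⊛-assoc []       ys zs = ≡.refl
    ⊛-assoc (x ∷ xs) ys zs = ≡.trans
      (cartesianProductWith-distribʳ-++ _∙_ (map (x ∙_) ys) (xs ⊛ ys) zs)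
      (cong₂ _++_ (map-⊛ x ys zs) (⊛-assoc xs ys zs))

    ⊛-identityˡ : ∀ xs → [ ε ] ⊛ xs ≡ xs
    ⊛-identityˡ xs =
      ≡.trans (++-identityʳ _) (≡.trans (map-cong M.identityˡ xs) (map-id xs))

  -- Lists up to permutation are finite multisets, so this is the monoid semiring of the given
  -- monoid over the natural numbers.
  ++-cartesianProductWith-isCommutativeSemiring :
    IsCommutativeSemiring _↭_ _++_ (cartesianProductWith _∙_) [] [ ε ]
  ++-cartesianProductWith-isCommutativeSemiring = Biased.isCommutativeSemiringˡ record
    { +-isCommutativeMonoid = ++-isCommutativeMonoid
    ; *-isCommutativeMonoid = Biased.isCommutativeMonoidˡ record
      { isSemigroup = record
        { isMagma = record
          { isEquivalence = ↭-isEquivalence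
          -- Congruence in the left factor comes from the right one by commuting there and back.
          ; ∙-cong = λ {xs} {ys} {us} {vs} p q → trans (⊛-congˡ xs q)
              (trans (⊛-comm xs vs) (trans (⊛-congˡ vs p) (⊛-comm vs ys)))
          }
        ; assoc = λ xs ys zs → ↭-reflexive (⊛-assoc xs ys zs)
        }
      ; identityˡ = λ xs → ↭-reflexive (⊛-identityˡ xs)
      ; comm = ⊛-comm
      }
    ; distribʳ = λ xs ys zs → ↭-reflexive (cartesianProductWith-distribʳ-++ _∙_ ys zs xs)
    ; zeroˡ = λ _ → ↭-refl
    }

-- Laurent polynomials

module ℒ = ℤ[q,q⁻¹]

-- The equality `_↭_` is finer than `ℒ._≈_`: it neither merges terms of equal exponent nor deletes
-- zero coefficients. Terms multiply componentwise in the monoid of pairs.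
Laurent : CommutativeSemiring 0ℓ 0ℓ
Laurent = record
  { Carrier = ℒ.Carrier
  ; _≈_ = _↭_
  ; _+_ = ℒ._+_
  ; _*_ = ℒ._*_
  ; 0# = ℒ.0#
  ; 1# = ℒ.1#
  ; isCommutativeSemiring = ++-cartesianProductWith-isCommutativeSemiring record
    { isMonoid = record
      { isSemigroup = record
        { isMagma = record { isEquivalence = ≡.isEquivalence ; ∙-cong = cong₂ _ }
        ; assoc = λ (c , d) (c′ , d′) (c″ , d″) →
            cong₂ _,_ (ℤ.*-assoc c c′ c″) (ℤ.+-assoc d d′ d″)
        }
      ; identity = (λ (c , d) → cong₂ _,_ (ℤ.*-identityˡ c) (ℤ.+-identityˡ d))
                 , (λ (c , d) → cong₂ _,_ (ℤ.*-identityʳ c) (ℤ.+-identityʳ d))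
      }
    ; comm = λ (c , d) (c′ , d′) → cong₂ _,_ (ℤ.*-comm c c′) (ℤ.+-comm d d′)
    }
  }

open module R = CommutativeSemiring Laurent
  using (+-cong; +-congʳ; *-congˡ; *-assoc; distribˡ; zeroʳ; *-identityʳ)

contribution : ℤ → ℤ × ℤ → ℤ
contribution e (c , d) = if does (d ℤ.≟ e) then c else + 0

-- A coefficient is a sum over all terms, and addition of integers is commutative.
↭⇒≈ : ∀ {p r} → p ↭ r → p ℒ.≈ r
↭⇒≈ refl e = ≡.refl
↭⇒≈ (prep t p↭r) e = cong (λ s → contribution e t + s) (↭⇒≈ p↭r e)
↭⇒≈ (swap {p} {r} t u p↭r) e = ≡.trans
  (cong (λ s → contribution e t + (contribution e u + s)) (↭⇒≈ p↭r e))
  (x∙yz≈y∙xz (contribution e t) (contribution e u) (ℒ.coeff r e))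
  where
  open CommutativeSemigroupProperties ℤ.+-commutativeSemigroup using (x∙yz≈y∙xz)
↭⇒≈ (trans p↭r r↭s) e = ≡.trans (↭⇒≈ p↭r e) (↭⇒≈ r↭s e)

-- Products are formed term by term; `ℤ.pos-*` treats the coefficients, while the exponents agree by
-- computation.
ι-* : ∀ p r → ι (p ℕ[q].* r) ≡ ι p ℒ.* ι r
ι-* []            r = ≡.refl
ι-* ((c , d) ∷ p) r = ≡.trans (map-++ _ (map _ r) (p ℕ[q].* r)) (cong₂ _++_
  (≡.trans (≡.sym (map-∘ r))
    (≡.trans (map-cong (λ (c′ , d′) → cong (_, _) (ℤ.pos-* c c′)) r) (map-∘ r)))
  (ι-* p r))

-- Finite sums over an initial segment

foldr-applyUpTo : ∀ f n →
  foldr ℒ._+_ ℒ.0# (applyUpTo f n) ≡ SemiringSum.sum R.semiring {n} (f ∘ toℕ)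
foldr-applyUpTo f zero    = ≡.refl
foldr-applyUpTo f (suc n) = cong (f 0 ++_) (foldr-applyUpTo (f ∘ suc) n)

Σ≤≡sum : ∀ k f → ℒ.Σ≤ k f ≡ SemiringSum.sum R.semiring {suc k} (f ∘ toℕ)
Σ≤≡sum k f = ≡.trans
  (cong (foldr ℒ._+_ ℒ.0#) (map-applyUpTo (λ i → i) f (suc k))) (foldr-applyUpTo f (suc k))

module _ (k : ℕ) where

  open SemiringSum R.semiring

  Σ≤-cong : ∀ {f g} → (∀ {j} → j ≤ k → f j ↭ g j) → ℒ.Σ≤ k f ↭ ℒ.Σ≤ k g
  Σ≤-cong {f} {g} f↭g rewrite Σ≤≡sum k f | Σ≤≡sum k g =
    sum-cong-≋ (λ i → f↭g (s≤s⁻¹ (toℕ<n i)))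

  Σ≤-zero : ℒ.Σ≤ k (λ _ → ℒ.0#) ↭ ℒ.0#
  Σ≤-zero rewrite Σ≤≡sum k (λ _ → ℒ.0#) = sum-replicate-zero (suc k)

  Σ≤-+ : ∀ f g → ℒ.Σ≤ k (λ j → f j ℒ.+ g j) ↭ ℒ.Σ≤ k f ℒ.+ ℒ.Σ≤ k g
  Σ≤-+ f g rewrite Σ≤≡sum k (λ j → f j ℒ.+ g j) | Σ≤≡sum k f | Σ≤≡sum k g =
    ∑-distrib-+ {suc k} (f ∘ toℕ) (g ∘ toℕ)

  *-Σ≤ : ∀ p f → p ℒ.* ℒ.Σ≤ k f ↭ ℒ.Σ≤ k (λ j → p ℒ.* f j)
  *-Σ≤ p f rewrite Σ≤≡sum k (λ j → p ℒ.* f j) | Σ≤≡sum k f =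
    *-distribˡ-sum {suc k} p (f ∘ toℕ)

  Σ≤-suc : ∀ f → ℒ.Σ≤ (suc k) f ↭ ℒ.Σ≤ k f ℒ.+ f (suc k)
  Σ≤-suc f rewrite Σ≤≡sum (suc k) f | Σ≤≡sum k f = trans
    (sum-init-last {suc k} (f ∘ toℕ))
    (↭-reflexive (cong₂ _++_ (sum-cong-≗ {suc k} (λ i → cong f (toℕ-inject₁ i)))
                             (cong f (toℕ-fromℕ (suc k)))))

-- The convolution formula

-- Here `l` is the length of `y`. The value `l - k + j` is negative when the suffix of length
-- `k - j` is longer than `y`.
exponent : ℕ → ℕ → ℕ → ℤ
exponent l k j = + j * (+ l - + k + + j)

exponent-suc-suc : ∀ l k j → exponent (suc l) (suc k) j ≡ exponent l k j
exponent-suc-suc l k j = identity (+ l) (+ k) (+ j)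
  where
  -- `+ 1 + + l` computes to `+ suc l`, so the solver's identity applies directly.
  identity : ∀ l k j → j * ((+ 1 + l) - (+ 1 + k) + j) ≡ j * (l - k + j)
  identity = solve-∀

-- Writing `k` as `j + d`, with `d` the length of the suffix, avoids truncated subtraction.
exponent-suc : ∀ l j d → exponent (suc l) (j ℕ.+ d) j + + d ≡ + (j ℕ.+ d) + exponent l (j ℕ.+ d) j
exponent-suc l j d = identity (+ l) (+ j) (+ d)
  where
  identity : ∀ l j d → j * ((+ 1 + l) - (j + d) + j) + d ≡ (j + d) + j * (l - (j + d) + j)
  identity = solve-∀

module _ {A : Set a} (_≟_ : DecidableEquality A) where

  open QBinomial _≟_

  -- `k` is separate from `v` because `length (w ∷ʳ c)` does not reduce to a successor of
  -- `length w`.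
  summand : List A → List A → ℕ → List A → ℕ → ℒ.Carrier
  summand x y k v j =
    (ℒ.q^ exponent (length y) k j) ℒ.* ι (binom x (take j v)) ℒ.* ι (binom y (drop j v))

  ι-binom-∷ʳ : ∀ u v x y → ι (binom (u ∷ʳ x) (v ∷ʳ y)) ≡
    (ℒ.q^ (+ length (v ∷ʳ y))) ℒ.* ι (binom u (v ∷ʳ y)) ℒ.+ ι (δ x y) ℒ.* ι (binom u v)
  ι-binom-∷ʳ u v x y rewrite binom-∷ʳ u v x y = ≡.trans
    (map-++ _ (ℕ[q].q^ length (v ∷ʳ y) ℕ[q].* binom u (v ∷ʳ y)) (δ x y ℕ[q].* binom u v))
    (cong₂ _++_ (ι-* (ℕ[q].q^ length (v ∷ʳ y)) (binom u (v ∷ʳ y))) (ι-* (δ x y) (binom u v)))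

  -- As `j ≤ length w`, the letter `c` lies in the suffix, so the recursion acts on the right factor
  -- alone.
  summand-∷ʳ : ∀ x y b w c {j} → j ≤ length w →
    summand x (y ∷ʳ b) (suc (length w)) (w ∷ʳ c) j ↭
      (ℒ.q^ (+ suc (length w))) ℒ.* summand x y (suc (length w)) (w ∷ʳ c) j ℒ.+
      ι (δ b c) ℒ.* summand x y (length w) w j
  summand-∷ʳ x y b w c {j} j≤w
    rewrite take-++-≤ w [ c ] j≤w | drop-++-≤ w [ c ] j≤w | length-∷ʳ y b = begin
    P ℒ.* X ℒ.* ι (binom (y ∷ʳ b) (w′ ∷ʳ c))
      ≡⟨ cong (P ℒ.* X ℒ.*_) (ι-binom-∷ʳ y w′ b c) ⟩
    P ℒ.* X ℒ.* (Q ℒ.* Y ℒ.+ D ℒ.* Z)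
      ≈⟨ distribˡ (P ℒ.* X) (Q ℒ.* Y) (D ℒ.* Z) ⟩
    P ℒ.* X ℒ.* (Q ℒ.* Y) ℒ.+ P ℒ.* X ℒ.* (D ℒ.* Z)
      ≈⟨ +-cong (interchange P X Q Y) (x∙yz≈y∙xz (P ℒ.* X) D Z) ⟩
    P ℒ.* Q ℒ.* (X ℒ.* Y) ℒ.+ D ℒ.* (P ℒ.* X ℒ.* Z)
      -- A product of powers of q computes to a single term, so only exponents are left to compare.
      ≡⟨ cong₂ (λ e f → (ℒ.q^ e) ℒ.* (X ℒ.* Y) ℒ.+ D ℒ.* ((ℒ.q^ f) ℒ.* X ℒ.* Z))
           exponents (exponent-suc-suc (length y) (length w) j) ⟩
    K ℒ.* P₁ ℒ.* (X ℒ.* Y) ℒ.+ D ℒ.* (P₂ ℒ.* X ℒ.* Z)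
      ≈⟨ +-congʳ (trans (*-assoc K P₁ (X ℒ.* Y)) (*-congˡ {K} (R.sym (*-assoc P₁ X Y)))) ⟩
    K ℒ.* (P₁ ℒ.* X ℒ.* Y) ℒ.+ D ℒ.* (P₂ ℒ.* X ℒ.* Z) ∎
    where
    open import Relation.Binary.Reasoning.Setoid R.setoid
    open CommutativeSemigroupProperties R.*-commutativeSemigroup using (interchange; x∙yz≈y∙xz)
    k = suc (length w)
    w′ = drop j w
    P = ℒ.q^ exponent (suc (length y)) k j
    P₁ = ℒ.q^ exponent (length y) k j
    P₂ = ℒ.q^ exponent (length y) (length w) j
    Q = ℒ.q^ (+ length (w′ ∷ʳ c))
    K = ℒ.q^ (+ k)
    D = ι (δ b c)
    X = ι (binom x (take j w))
    Y = ι (binom y (w′ ∷ʳ c))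
    Z = ι (binom y w′)
    j+∣w′c∣≡k : j ℕ.+ length (w′ ∷ʳ c) ≡ k
    j+∣w′c∣≡k = ≡.trans (cong (j ℕ.+_) (length-∷ʳ w′ c)) (≡.trans (ℕ.+-suc j (length w′))
      (cong suc (≡.trans (cong (j ℕ.+_) (length-drop j w)) (ℕ.m+[n∸m]≡n j≤w))))
    exponents : exponent (suc (length y)) k j + + length (w′ ∷ʳ c) ≡ + k + exponent (length y) k j
    exponents = ≡.subst
      (λ k → exponent (suc (length y)) k j + + length (w′ ∷ʳ c) ≡ + k + exponent (length y) k j)
      j+∣w′c∣≡k (exponent-suc (length y) j (length (w′ ∷ʳ c)))

  summand-last : ∀ x y v {k} → length v ≡ k →
    summand x y k v k ↭ (ℒ.q^ exponent (length y) k k) ℒ.* ι (binom x v)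
  summand-last x y v ≡.refl
    rewrite take-all (length v) v ℕ.≤-refl | drop-all (length v) v ℕ.≤-refl = *-identityʳ _

  -- At `j = k` the suffix is empty and there is no delta term; the factor `q^ k` comes from the
  -- exponent `k * l` growing by `k`.
  summand-last-∷ʳ : ∀ x y b v {k} → length v ≡ k →
    summand x (y ∷ʳ b) k v k ↭ (ℒ.q^ (+ k)) ℒ.* summand x y k v k
  summand-last-∷ʳ x y b v {k} ∣v∣≡k = begin
    summand x (y ∷ʳ b) k v k
      ≈⟨ summand-last x (y ∷ʳ b) v ∣v∣≡k ⟩
    (ℒ.q^ exponent (length (y ∷ʳ b)) k k) ℒ.* X
      ≡⟨ cong (λ e → (ℒ.q^ e) ℒ.* X) (≡.trans (cong (λ l → exponent l k k) (length-∷ʳ y b))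
           (identity (+ length y) (+ k))) ⟩
    (ℒ.q^ (+ k)) ℒ.* (ℒ.q^ exponent (length y) k k) ℒ.* X
      ≈⟨ *-assoc (ℒ.q^ (+ k)) (ℒ.q^ exponent (length y) k k) X ⟩
    (ℒ.q^ (+ k)) ℒ.* ((ℒ.q^ exponent (length y) k k) ℒ.* X)
      ≈⟨ *-congˡ {ℒ.q^ (+ k)} (summand-last x y v ∣v∣≡k) ⟨
    (ℒ.q^ (+ k)) ℒ.* summand x y k v k ∎
    where
    open import Relation.Binary.Reasoning.Setoid R.setoid
    X = ι (binom x v)
    identity : ∀ l k → k * ((+ 1 + l) - k + k) ≡ k + k * (l - k + k)
    identity = solve-∀

  summand-[]-∷ʳ : ∀ x k w c {j} → j ≤ length w → summand x [] k (w ∷ʳ c) j ↭ ℒ.0#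
  summand-[]-∷ʳ x k w c {j} j≤w
    rewrite drop-++-≤ w [ c ] j≤w | ε-binom (drop j w ∷ʳ c) (∷ʳ-≢[] (drop j w) c) =
    zeroʳ ((ℒ.q^ exponent 0 k j) ℒ.* ι (binom x (take j (w ∷ʳ c))))

  -- Only `j = k` survives, since every other suffix is nonempty, and its exponent is zero.
  ι-binom-++-[] : ∀ x v {k} → length v ≡ k → ι (binom x v) ↭ ℒ.Σ≤ k (summand x [] k v)
  ι-binom-++-[] x v ∣v∣≡k with initLast v
  ι-binom-++-[] x .[] ≡.refl | [] = ↭-refl
  ι-binom-++-[] x .(w ∷ʳ c) {k} ∣v∣≡k | w ∷ʳ′ c
    with ≡.refl ← ≡.trans (≡.sym (length-∷ʳ w c)) ∣v∣≡k = begin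
    ι (binom x v)
      ≈⟨ R.*-identityˡ (ι (binom x v)) ⟨
    ℒ.1# ℒ.* ι (binom x v)
      ≡⟨ cong (λ e → (ℒ.q^ e) ℒ.* ι (binom x v)) (identity (+ k)) ⟨
    (ℒ.q^ exponent 0 k k) ℒ.* ι (binom x v)
      ≈⟨ summand-last x [] v ∣v∣≡k ⟨
    summand x [] k v k
      ≈⟨ +-congʳ (trans (Σ≤-cong (length w) (summand-[]-∷ʳ x k w c)) (Σ≤-zero (length w))) ⟨
    ℒ.Σ≤ (length w) (summand x [] k v) ℒ.+ summand x [] k v k
      ≈⟨ Σ≤-suc (length w) (summand x [] k v) ⟨
    ℒ.Σ≤ k (summand x [] k v) ∎
    where
    open import Relation.Binary.Reasoning.Setoid R.setoid
    v = w ∷ʳ c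
    identity : ∀ k → k * (+ 0 - k + k) ≡ + 0
    identity = solve-∀

  ι-binom-++ : ∀ x {y} → Reverse y → ∀ v {k} → length v ≡ k →
    ι (binom (x ++ y) v) ↭ ℒ.Σ≤ k (summand x y k v)
  ι-binom-++ x [] v ∣v∣≡k rewrite ++-identityʳ x = ι-binom-++-[] x v ∣v∣≡k
  ι-binom-++ x (y ∶ ry ∶ʳ b) v ∣v∣≡k with initLast v
  -- With `k = 0` the exponent `+ 0 * _` computes to zero, so both sides reduce to the term 1.
  ι-binom-++ x (y ∶ ry ∶ʳ b) .[] ≡.refl | [] = ↭-refl
  ι-binom-++ x (y ∶ ry ∶ʳ b) .(w ∷ʳ c) {k} ∣v∣≡k | w ∷ʳ′ c
    -- Makes `k` the successor of `m`, so that `Σ≤-suc` can split off the index `k`.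
    with ≡.refl ← ≡.trans (≡.sym (length-∷ʳ w c)) ∣v∣≡k = begin
    ι (binom (x ++ (y ∷ʳ b)) v)
      ≡⟨ cong (λ u → ι (binom u v)) (++-assoc x y [ b ]) ⟨
    ι (binom ((x ++ y) ∷ʳ b) v)
      ≡⟨ ι-binom-∷ʳ (x ++ y) w b c ⟩
    (ℒ.q^ (+ length v)) ℒ.* ι (binom (x ++ y) v) ℒ.+ D ℒ.* ι (binom (x ++ y) w)
      ≡⟨ cong (λ l → (ℒ.q^ (+ l)) ℒ.* ι (binom (x ++ y) v) ℒ.+ D ℒ.* ι (binom (x ++ y) w)) ∣v∣≡k ⟩
    K ℒ.* ι (binom (x ++ y) v) ℒ.+ D ℒ.* ι (binom (x ++ y) w)
      ≈⟨ +-cong (*-congˡ {K} (ι-binom-++ x ry v ∣v∣≡k)) (*-congˡ {D} (ι-binom-++ x ry w ≡.refl)) ⟩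
    K ℒ.* ℒ.Σ≤ k f ℒ.+ D ℒ.* ℒ.Σ≤ m g
      -- The delta sum stops at `m`, so the index `k` of the other sum is set aside before the two
      -- are merged.
      ≈⟨ +-congʳ (*-congˡ {K} (Σ≤-suc m f)) ⟩
    K ℒ.* (ℒ.Σ≤ m f ℒ.+ f k) ℒ.+ D ℒ.* ℒ.Σ≤ m g
      ≈⟨ +-congʳ (distribˡ K (ℒ.Σ≤ m f) (f k)) ⟩
    (K ℒ.* ℒ.Σ≤ m f ℒ.+ K ℒ.* f k) ℒ.+ D ℒ.* ℒ.Σ≤ m g
      ≈⟨ xy∙z≈xz∙y (K ℒ.* ℒ.Σ≤ m f) (K ℒ.* f k) (D ℒ.* ℒ.Σ≤ m g) ⟩
    (K ℒ.* ℒ.Σ≤ m f ℒ.+ D ℒ.* ℒ.Σ≤ m g) ℒ.+ K ℒ.* f k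
      ≈⟨ +-congʳ (+-cong (*-Σ≤ m K f) (*-Σ≤ m D g)) ⟩
    (ℒ.Σ≤ m (λ j → K ℒ.* f j) ℒ.+ ℒ.Σ≤ m (λ j → D ℒ.* g j)) ℒ.+ K ℒ.* f k
      ≈⟨ +-congʳ (Σ≤-+ m (λ j → K ℒ.* f j) (λ j → D ℒ.* g j)) ⟨
    ℒ.Σ≤ m (λ j → K ℒ.* f j ℒ.+ D ℒ.* g j) ℒ.+ K ℒ.* f k
      ≈⟨ +-cong (Σ≤-cong m (summand-∷ʳ x y b w c)) (summand-last-∷ʳ x y b v ∣v∣≡k) ⟨
    ℒ.Σ≤ m h ℒ.+ h k
      ≈⟨ Σ≤-suc m h ⟨
    ℒ.Σ≤ k h ∎
    where
    open import Relation.Binary.Reasoning.Setoid R.setoid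
    open CommutativeSemigroupProperties R.+-commutativeSemigroup using (xy∙z≈xz∙y)
    m = length w
    v = w ∷ʳ c
    K = ℒ.q^ (+ k)
    D = ι (δ b c)
    f = summand x y k v
    g = summand x y m w
    h = summand x (y ∷ʳ b) k v

corollary3p3 : ∀ {ℓ} {A : Set ℓ} {n : ℕ} (A↔Fin : A ↔ Fin n) →
    let open QBinomial (inj⇒≟ (↔⇒↣ A↔Fin))
        module L = ℤ[q,q⁻¹]
    in
    ∀ (x y : List A) (k : ℕ) (as : Vec A k) →
    ι (binom (x ++ y) (toList as))
      L.≈
    L.Σ≤ k (λ j →
      (L.q^ (+ j * (+ length y - + k + + j)))
        L.* ι (binom x (take j (toList as)))
        L.* ι (binom y (drop j (toList as))))
corollary3p3 A↔Fin x y k as =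
  ↭⇒≈ (ι-binom-++ (inj⇒≟ (↔⇒↣ A↔Fin)) x (reverseView y) (toList as) (length-toList as))
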